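{- Let $P$ be a poset and let $\alpha>0$ be a countable limit ordinal. If $I(P^{<\alpha})$ is wqo, then $P^\alpha$ and $P^{<\alpha}$ are wqo.
   Context: A poset is wqo if it has no infinite antichain and no infinite strictly decreasing sequence. For a poset $P$ and ordinal $\alpha$, $P^\alpha$ is the poset obtained by factoring the quasi-order on the set of all $\alpha$-sequences from $P$ given by $s\le t$ iff there is a strictly increasing $\rho:\alpha\to\alpha$ with $s(\gamma)\le_P t(\rho(\gamma))$ for all $\gamma<\alpha$ (factoring by mutual $\le$). $P^{<\alpha}$ is defined similarly on all sequences of length $<\alpha$ from $P$, with $s\le t$ iff there is a strictly increasing $\rho:\mathrm{dom}(s)\to\mathrm{dom}(t)$ with $s(\gamma)\le_P t(\rho(\gamma))$ for all $\gamma\in\mathrm{dom}(s)$. For a poset $Q$, $I(Q)$ is the set of initial segments (downward closed subsets) of $Q$ ordered by inclusion. -}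

module Defs where

open import Level using (Level; _⊔_; suc)
open import Data.Nat using (ℕ) renaming (suc to sucℕ)
open import Data.Product using (Σ; ∃-syntax; _×_; proj₁; proj₂)
open import Relation.Nullary using (¬_)
open import Relation.Binary.PropositionalEquality using (_≡_; _≢_)
open import Relation.Binary.Structures using (IsStrictTotalOrder)
open import Relation.Binary.Bundles using (Poset)
open import Induction.WellFounded using (WellFounded)
open import Relation.Unary using (Pred)

-- wqo for a quasi-order (A, ≲), i.e. wqo of its quotient poset.

NoInfiniteAntichain : ∀ {a r} (A : Set a) (_≲_ : A → A → Set r) → Set (a ⊔ r)
NoInfiniteAntichain A _≲_ =
  ¬ (Σ (ℕ → A) λ f → ∀ i j → i ≢ j → ¬ (f i ≲ f j))

NoInfiniteDescending : ∀ {a r} (A : Set a) (_≲_ : A → A → Set r) → Set (a ⊔ r)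
NoInfiniteDescending A _≲_ =
  ¬ (Σ (ℕ → A) λ f → ∀ n → (f (sucℕ n) ≲ f n) × ¬ (f n ≲ f (sucℕ n)))

IsWQO : ∀ {a r} (A : Set a) (_≲_ : A → A → Set r) → Set (a ⊔ r)
IsWQO A _≲_ = NoInfiniteAntichain A _≲_ × NoInfiniteDescending A _≲_

-- A countable limit ordinal α > 0: its set of elements is countably
-- infinite, so it is presented as a well-ordering _≺_ of ℕ without a
-- largest element.

record CountableLimitOrdinal : Set₁ where
  field
    _≺_                : ℕ → ℕ → Set
    isStrictTotalOrder : IsStrictTotalOrder _≡_ _≺_
    wellFounded        : WellFounded _≺_
    noMaximum          : ∀ x → ∃[ y ] (x ≺ y)

  Below : ℕ → Set
  Below b = Σ ℕ λ x → x ≺ b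

module _ {c ℓ₁ ℓ₂} (P : Poset c ℓ₁ ℓ₂) (α : CountableLimitOrdinal) where
  open Poset P renaming (Carrier to |P|; _≤_ to _≤P_)
  open CountableLimitOrdinal α

  SeqA : Set c
  SeqA = ℕ → |P|

  _≤A_ : SeqA → SeqA → Set ℓ₂
  s ≤A t = Σ (ℕ → ℕ) λ ρ →
             (∀ {x y} → x ≺ y → ρ x ≺ ρ y) × (∀ γ → s γ ≤P t (ρ γ))

  -- P^{<α} : sequences of length β < α; each β < α is {x | x ≺ b}
  SeqLt : Set c
  SeqLt = Σ ℕ λ b → (Below b → |P|)

  _≤Lt_ : SeqLt → SeqLt → Set ℓ₂
  s ≤Lt t = Σ (Below (proj₁ s) → Below (proj₁ t)) λ ρ →
      (∀ {x y} → proj₁ x ≺ proj₁ y → proj₁ (ρ x) ≺ proj₁ (ρ y))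
    × (∀ γ → proj₂ s γ ≤P proj₂ t (ρ γ))

  InitialSegment : Set (suc (c ⊔ ℓ₁ ⊔ ℓ₂))
  InitialSegment = Σ (Pred SeqLt (c ⊔ ℓ₁ ⊔ ℓ₂)) λ D →
                     ∀ {s t} → s ≤Lt t → D t → D s

  _⊆I_ : InitialSegment → InitialSegment → Set (c ⊔ ℓ₁ ⊔ ℓ₂)
  D ⊆I E = ∀ s → proj₁ D s → proj₁ E s

{-# OPTIONS --safe #-}

-- A sequence s of length α is determined, up to mutual ≤, by the initial
-- segment ↓s of all sequences of length < α that embed in s.  Indeed, if
-- ↓s ⊆ ↓t then every proper initial part of s embeds in t; sending γ to the
-- least position that can be the image of γ under such a partial embedding
-- gives an embedding of s in t.  Hence P^α, like P^{<α}, inherits wqo from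
-- I(P^{<α}).
--
-- Collecting these least positions into a function needs the double-negation
-- shift, which is not available constructively but follows from the hypothesis.
-- If every C n holds classically, let D k be the set of sequences s such that
-- C m holds for all m ≤ |s| + k.  The D k decrease, and D k ⊆ D (k + 1) would
-- yield all C n by induction on n.

module Submission where

open import Defs
open import Data.Empty using (⊥-elim)
open import Data.Nat using (ℕ; zero; suc; _+_; _≤_; z≤n; s≤s⁻¹)
open import Data.Nat.Properties
  using (≤-trans; ≤-reflexive; m≤n⇒m<n∨m≡n; m≤m+n; n≤1+n;
         +-monoˡ-≤; +-monoʳ-≤; +-suc; ≰⇒>; _≤?_)
open import Data.Product using (Σ; ∃-syntax; _×_; _,_; proj₁; proj₂)
open import Data.Sum using (inj₁; inj₂)
open import Data.Unit using (⊤; tt)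
open import Function using (id; _∘_)
open import Induction.WellFounded using (Acc; acc)
open import Level using (Lift; lift; lower; _⊔_)
open import Relation.Binary.Bundles using (Poset)
open import Relation.Binary.Definitions using (tri<; tri≈; tri>)
open import Relation.Binary.PropositionalEquality
  using (_≡_; refl; subst; sym)
open import Relation.Binary.Structures using (IsStrictTotalOrder)
open import Relation.Nullary using (¬_; yes; no)

-- Both halves of `IsWQO` are negations, so `g` turns a bad sequence in `A` into one in `B` even if
-- it reflects the order only up to double negation.
IsWQO-reflect : ∀ {a b r q} {A : Set a} {B : Set b}
  (_≲_ : A → A → Set r) (_⊑_ : B → B → Set q) (g : A → B) →
  (∀ x y → x ≲ y → g x ⊑ g y) →
  (∀ x y → g x ⊑ g y → ¬ ¬ (x ≲ y)) →
  IsWQO B _⊑_ → IsWQO A _≲_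
IsWQO-reflect _≲_ _⊑_ g mono reflect (noAntichain , noDescending) =
    (λ (f , anti) → noAntichain
      (g ∘ f , λ i j i≢j gi⊑gj → reflect _ _ gi⊑gj (anti i j i≢j)))
  , (λ (f , desc) → noDescending
      (g ∘ f , λ n → mono _ _ (proj₁ (desc n)) ,
                     λ gn⊑gsn → reflect _ _ gn⊑gsn (proj₂ (desc n))))

-- Finitely many double negations can be removed one after another when the goal is a contradiction.
¬¬-bounded : ∀ {a} {C : ℕ → Set a} → (∀ n → ¬ ¬ C n) →
  ∀ k → ¬ ¬ (∀ m → m ≤ k → C m)
¬¬-bounded ¬¬C zero    ¬all = ¬¬C 0 λ c → ¬all λ { .0 z≤n → c }
¬¬-bounded {C = C} ¬¬C (suc k) ¬all =
  ¬¬-bounded ¬¬C k λ below → ¬¬C (suc k) λ c → ¬all λ m m≤1+k →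
    extend below c m (m≤n⇒m<n∨m≡n m≤1+k)
  where
  extend : (∀ m → m ≤ k → C m) → C (suc k) → ∀ m → _ → C m
  extend below c m (inj₁ m<1+k) = below m (s≤s⁻¹ m<1+k)
  extend below c m (inj₂ refl)  = c

module _ (α : CountableLimitOrdinal) where
  open CountableLimitOrdinal α
  open IsStrictTotalOrder isStrictTotalOrder
    using (compare) renaming (trans to ≺-trans)

  Least : ∀ {q} → (ℕ → Set q) → ℕ → Set q
  Least Q x = Q x × (∀ y → Q y → ¬ (y ≺ x))

  ¬¬-least : ∀ {q} {Q : ℕ → Set q} {x} → Q x → ¬ ¬ (Σ ℕ (Least Q))
  ¬¬-least {Q = Q} {x} q ¬least = none x (wellFounded x) q
    where
    none : ∀ x → Acc _≺_ x → ¬ Q x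
    none x (acc rs) q = ¬least (x , q , λ y qy y≺x → none y (rs y≺x) qy)

  -- A chain of `n` steps descending from `b` bounds the position of `b` in α from below, also when
  -- that position is infinite. The least such `b` is the `n`-th element of α.
  RankAtLeast : ℕ → ℕ → Set
  RankAtLeast zero    b = ⊤
  RankAtLeast (suc n) b = ∃[ y ] (y ≺ b × RankAtLeast n y)

  rankAtLeast-exists : ∀ n → ∃[ b ] RankAtLeast n b
  rankAtLeast-exists zero    = 0 , tt
  rankAtLeast-exists (suc n) with rankAtLeast-exists n
  ... | y , ry with noMaximum y
  ...   | b , y≺b = b , y , y≺b , ry

  rankAtLeast-pred : ∀ n {b} → RankAtLeast (suc n) b → RankAtLeast n b
  rankAtLeast-pred zero    _              = tt
  rankAtLeast-pred (suc n) (y , y≺b , ry) = y , y≺b , rankAtLeast-pred n ry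

  rankAtLeast-antitone : ∀ {m n b} → m ≤ n → RankAtLeast n b → RankAtLeast m b
  rankAtLeast-antitone {n = zero}  z≤n r = r
  rankAtLeast-antitone {n = suc n} m≤1+n r with m≤n⇒m<n∨m≡n m≤1+n
  ... | inj₁ m<1+n = rankAtLeast-antitone (s≤s⁻¹ m<1+n) (rankAtLeast-pred n r)
  ... | inj₂ refl  = r

  rank-of-least : ∀ {m n b} → Least (RankAtLeast n) b → RankAtLeast m b → m ≤ n
  rank-of-least {m} {n} (_ , least) rm with m ≤? n
  ... | yes m≤n = m≤n
  ... | no  m≰n with rankAtLeast-antitone (≰⇒> m≰n) rm
  ...   | y , y≺b , ry = ⊥-elim (least y ry y≺b)

  rankAtLeast-transfer : ∀ {b b'} (ρ : Below b → Below b') →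
    (∀ {x y} → proj₁ x ≺ proj₁ y → proj₁ (ρ x) ≺ proj₁ (ρ y)) →
    ∀ n → RankAtLeast n b → RankAtLeast n b'
  rankAtLeast-transfer {b} ρ mono = λ where
      zero    _              → tt
      (suc n) (y , y≺b , ry) → proj₁ (ρ (y , y≺b)) , proj₂ (ρ (y , y≺b)) ,
                               image n (y , y≺b) ry
    where
    -- `ρ` is undefined at `b` itself, so the chain is mapped from its first element below `b`
    -- onwards.
    image : ∀ n (x : Below b) → RankAtLeast n (proj₁ x) →
      RankAtLeast n (proj₁ (ρ x))
    image zero    _         _              = tt
    image (suc n) (x , x≺b) (y , y≺x , ry) =
      let z = y , ≺-trans y≺x x≺b in proj₁ (ρ z) , mono y≺x , image n z ry

  module _ {c ℓ₁ ℓ₂} (P : Poset c ℓ₁ ℓ₂) where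
    private
      module P = Poset P
      ℓ = c ⊔ ℓ₁ ⊔ ℓ₂

    ≤Lt-refl : ∀ s → _≤Lt_ P α s s
    ≤Lt-refl _ = id , id , λ _ → P.refl

    ≤Lt-trans : ∀ s t u → _≤Lt_ P α s t → _≤Lt_ P α t u → _≤Lt_ P α s u
    ≤Lt-trans _ _ _ (ρ , ρ-mono , s≤t) (σ , σ-mono , t≤u) =
      σ ∘ ρ , (λ x≺y → σ-mono (ρ-mono x≺y)) ,
      λ γ → P.trans (s≤t γ) (t≤u (ρ γ))

    ↓Lt : SeqLt P α → InitialSegment P α
    ↓Lt s = (λ u → Lift ℓ (_≤Lt_ P α u s)) ,
            λ {u} {v} u≤v v≤s → lift (≤Lt-trans u v s u≤v (lower v≤s))

    SeqLt-isWQO : IsWQO (InitialSegment P α) (_⊆I_ P α) →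
                  IsWQO (SeqLt P α) (_≤Lt_ P α)
    SeqLt-isWQO = IsWQO-reflect (_≤Lt_ P α) (_⊆I_ P α) ↓Lt
      (λ s t s≤t u u≤s → lift (≤Lt-trans u s t (lower u≤s) s≤t))
      (λ s t ↓s⊆↓t ¬s≤t → ¬s≤t (lower (↓s⊆↓t s (lift (≤Lt-refl s)))))

    EmbedsIn : SeqLt P α → SeqA P α → Set ℓ₂
    EmbedsIn (b , u) t = Σ (Below b → ℕ) λ ρ →
      (∀ {x y} → proj₁ x ≺ proj₁ y → ρ x ≺ ρ y) × (∀ γ → u γ P.≤ t (ρ γ))

    ↓A : SeqA P α → InitialSegment P α
    ↓A t = (λ u → Lift ℓ (EmbedsIn u t)) ,
           λ (σ , σ-mono , u≤v) (lift (ρ , ρ-mono , v≤t)) →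
             lift (ρ ∘ σ , (λ x≺y → ρ-mono (σ-mono x≺y)) ,
                   λ γ → P.trans (u≤v γ) (v≤t (σ γ)))

    ↓A-mono : ∀ s t → _≤A_ P α s t → _⊆I_ P α (↓A s) (↓A t)
    ↓A-mono s t (ρ , ρ-mono , s≤t) u (lift (σ , σ-mono , u≤s)) =
      lift (ρ ∘ σ , (λ x≺y → ρ-mono (σ-mono x≺y)) ,
            λ γ → P.trans (u≤s γ) (s≤t (σ γ)))

    double-negation-shift : NoInfiniteDescending (InitialSegment P α) (_⊆I_ P α) →
      P.Carrier → {A : ℕ → Set ℓ} → (∀ n → ¬ ¬ A n) → ¬ ¬ (∀ n → A n)
    double-negation-shift noDescending p {A} ¬¬A ¬∀A =
      noDescending (D , λ k → D-decreasing k , D-strict k)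
      where
      -- The n-th element of α only exists classically; bundling it with A n
      -- makes it available in the induction that establishes all A n.
      C : ℕ → Set ℓ
      C n = A n × Σ ℕ (Least (RankAtLeast n))

      ¬¬C : ∀ n → ¬ ¬ C n
      ¬¬C n ¬c = ¬¬A n λ a →
        ¬¬-least (proj₂ (rankAtLeast-exists n)) λ least → ¬c (a , least)

      D : ℕ → InitialSegment P α
      -- For infinite `s` this demands every `C m`. Embeddings preserve lower bounds on the length,
      -- whence downward closure.
      D k = (λ s → ∀ n → RankAtLeast n (proj₁ s) → ∀ m → m ≤ n + k → C m) ,
            λ (ρ , ρ-mono , _) Dt n r →
              Dt n (rankAtLeast-transfer ρ ρ-mono n r)

      D-decreasing : ∀ k → _⊆I_ P α (D (suc k)) (D k)
      D-decreasing k s Ds n r m m≤n+k =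
        Ds n r m (≤-trans m≤n+k (+-monoʳ-≤ n (n≤1+n k)))

      D-strict : ∀ k → ¬ _⊆I_ P α (D k) (D (suc k))
      D-strict k D⊆ = ¬¬-bounded ¬¬C k λ base →
          ¬∀A λ n → proj₁ (all base n n (m≤m+n n k))
        where
        all : (∀ m → m ≤ k → C m) → ∀ n m → m ≤ n + k → C m
        all base zero    = base
        all base (suc n) m m≤1+n+k =
          let b , least = proj₂ (all base n n (m≤m+n n k))
          -- The constant sequence of length exactly `n` lies in `D k` by the induction hypothesis;
          -- membership in `D (suc k)` gains one more index.
          in D⊆ (b , λ _ → p)
                (λ n' r m' m'≤n'+k → all base n m'
                  (≤-trans m'≤n'+k (+-monoˡ-≤ k (rank-of-least least r))))
                n (proj₁ least) m
                (≤-trans m≤1+n+k (≤-reflexive (sym (+-suc n k))))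

    ↓A-reflect : NoInfiniteDescending (InitialSegment P α) (_⊆I_ P α) →
      ∀ s t → _⊆I_ P α (↓A s) (↓A t) → ¬ ¬ _≤A_ P α s t
    ↓A-reflect noDescending s t ↓s⊆↓t ¬s≤t =
      -- `s 0` serves as the value of the constant sequences.
      double-negation-shift noDescending (s 0) ¬¬least λ least →
        let ρ       = λ γ → proj₁ (lower (least γ))
            isLeast = λ γ → proj₂ (lower (least γ))
        in ¬s≤t (ρ , increasing ρ isLeast , λ γ → below (proj₁ (isLeast γ)))
      where
      restrict : ℕ → SeqLt P α
      restrict b = b , s ∘ proj₁

      -- The length `b` varies freely, so an embedding used at a later position also competes at
      -- every earlier one.
      Image : ℕ → ℕ → Set ℓ₂
      Image γ δ = Σ ℕ λ b → Σ (γ ≺ b) λ γ≺b →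
        Σ (EmbedsIn (restrict b) t) λ e → proj₁ e (γ , γ≺b) ≡ δ

      below : ∀ {γ δ} → Image γ δ → s γ P.≤ t δ
      below (_ , γ≺b , (_ , _ , s≤t) , refl) = s≤t (_ , γ≺b)

      ¬¬least : ∀ γ → ¬ ¬ Lift ℓ (Σ ℕ (Least (Image γ)))
      -- As α is a limit, `γ` lies inside some proper initial part of `s`.
      ¬¬least γ ¬least with noMaximum γ
      ... | b , γ≺b = ¬¬-least {Q = Image γ} (b , γ≺b , lower inT , refl)
                        λ least → ¬least (lift least)
        where
        inT : Lift ℓ (EmbedsIn (restrict b) t)
        inT = ↓s⊆↓t (restrict b) (lift (proj₁ , (λ x≺y → x≺y) , λ _ → P.refl))

      -- The embedding `σ` attaining `ρ y` is also defined at `x`; minimality puts `ρ x` at or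
      -- before `σ x`, which precedes `σ y`.
      increasing : (ρ : ℕ → ℕ) → (∀ γ → Least (Image γ) (ρ γ)) →
        ∀ {x y} → x ≺ y → ρ x ≺ ρ y
      increasing ρ isLeast {x} {y} x≺y with proj₁ (isLeast y)
      ... | b , y≺b , e@(σ , σ-mono , _) , σy≡ρy
          = subst (ρ x ≺_) σy≡ρy ρx≺σy
        where
        x' = x , ≺-trans x≺y y≺b

        ρx≺σy : ρ x ≺ σ (y , y≺b)
        ρx≺σy with compare (ρ x) (σ x')
        ... | tri< ρx≺σx _ _ = ≺-trans ρx≺σx (σ-mono x≺y)
        ... | tri≈ _ ρx≡σx _ = subst (_≺ _) (sym ρx≡σx) (σ-mono x≺y)
        ... | tri> _ _ σx≺ρx =
          ⊥-elim (proj₂ (isLeast x) (σ x') (b , proj₂ x' , e , refl) σx≺ρx)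

mainTheorem4 : ∀ {c ℓ₁ ℓ₂} (P : Poset c ℓ₁ ℓ₂) (α : CountableLimitOrdinal) →
    IsWQO (InitialSegment P α) (_⊆I_ P α) →
    IsWQO (SeqA P α) (_≤A_ P α) × IsWQO (SeqLt P α) (_≤Lt_ P α)
mainTheorem4 P α wqo =
    IsWQO-reflect (_≤A_ P α) (_⊆I_ P α) (↓A α P) (↓A-mono α P)
      (↓A-reflect α P (proj₂ wqo)) wqo
  , SeqLt-isWQO α P wqo
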